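{- Let $k$ be a positive integer, let $G$ be a finite graph and let $X,Y\subseteq V(G)$. Suppose there exists a collection $\mathcal P$ of at least $16k$ pairwise vertex-disjoint $X$-$Y$-paths in $G$ such that every vertex in $V(\mathcal P)$ is incident to at most one edge in $E(G)\setminus E(\mathcal P)$. Then there exist at least $k$ pairwise non-adjacent $X$-$Y$-paths in $G$.
   Context: An $X$-$Y$-path is a path with one endpoint in $X$ and the other endpoint in $Y$; a single vertex of $X\cap Y$ counts as an $X$-$Y$-path (of length $0$). For a collection $\mathcal P$ of paths, $V(\mathcal P)=\bigcup_{P\in\mathcal P}V(P)$ and $E(\mathcal P)=\bigcup_{P\in\mathcal P}E(P)$. Paths are called pairwise non-adjacent if they are pairwise vertex-disjoint and there is no edge of $G$ joining a vertex of one of them to a vertex of another. -}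

module Defs where

open import Data.Nat using (ℕ; suc; _≤_; _*_)
open import Data.Bool using (Bool; true; false)
open import Data.Fin using (Fin)
open import Data.Fin.Subset using (Subset; _∈_)
open import Data.List using (List; []; _∷_; length)
open import Data.List.Membership.Propositional renaming (_∈_ to _∈ₗ_)
open import Data.List.Relation.Unary.Unique.Propositional using (Unique)
open import Data.List.Relation.Unary.Linked using (Linked)
open import Data.List.Relation.Unary.AllPairs using (AllPairs)
open import Data.Product using (Σ; _×_; ∃; ∃-syntax)
open import Data.Sum using (_⊎_)
open import Relation.Binary.PropositionalEquality using (_≡_)
open import Relation.Nullary using (¬_)

record Graph : Set where
  field
    n      : ℕ
    adj    : Fin n → Fin n → Bool
    sym    : ∀ u v → adj u v ≡ adj v u
    irrefl : ∀ v → adj v v ≡ false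

module _ (G : Graph) where
  open Graph G

  Adj : Fin n → Fin n → Set
  Adj u v = adj u v ≡ true

  record Path : Set where
    constructor mkPath
    field
      verts    : List (Fin n)
      nonempty : ¬ (verts ≡ [])
      distinct : Unique verts
      linked   : Linked Adj verts

  open Path public

  firstV : Fin n → List (Fin n) → Fin n
  firstV d []      = d
  firstV d (x ∷ _) = x

  lastV : Fin n → List (Fin n) → Fin n
  lastV d []       = d
  lastV d (x ∷ xs) = lastV x xs

  data Consec : List (Fin n) → Fin n → Fin n → Set where
    here  : ∀ {u v vs} → Consec (u ∷ v ∷ vs) u v
    there : ∀ {x vs u v} → Consec vs u v → Consec (x ∷ vs) u v

  OnPath : Path → Fin n → Set
  OnPath P v = v ∈ₗ verts P

  EdgeOf : Path → Fin n → Fin n → Set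
  EdgeOf P u v = Consec (verts P) u v ⊎ Consec (verts P) v u

  IsXYPath : Subset n → Subset n → Path → Set
  IsXYPath X Y P =
    ∃[ a ] ∃[ b ] (firstV a (verts P) ≡ a × lastV a (verts P) ≡ b)
      × ((a ∈ X × b ∈ Y) ⊎ (b ∈ X × a ∈ Y))

  InV : List Path → Fin n → Set
  InV 𝒫 v = ∃[ P ] (P ∈ₗ 𝒫 × OnPath P v)

  InE : List Path → Fin n → Fin n → Set
  InE 𝒫 u v = ∃[ P ] (P ∈ₗ 𝒫 × EdgeOf P u v)

  VertexDisjoint : Path → Path → Set
  VertexDisjoint P Q = ∀ v → OnPath P v → ¬ OnPath Q v

  NonAdjacent : Path → Path → Set
  NonAdjacent P Q = VertexDisjoint P Q
    × (∀ u v → OnPath P u → OnPath Q v → ¬ Adj u v)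

  AtMostOneExtraEdge : List Path → Set
  AtMostOneExtraEdge 𝒫 = ∀ v → InV 𝒫 v →
    ∀ u w → Adj v u → ¬ InE 𝒫 v u → Adj v w → ¬ InE 𝒫 v w → u ≡ w

{-# OPTIONS --safe #-}
-- By hypothesis the extra edges inside V(𝒫) form a matching M.  The edges of M can be coloured with
-- four colours so that any two joined by an edge of 𝒫 get different colours: going backwards through
-- the list of all path vertices, at most three neighbours are already coloured at each step.
--
-- The colours are then removed one after the other, each at the cost of half of the paths.  Let F be
-- the set of extra edges of the current colour.  Orient the paths from X to Y and let the paths cross
-- over, or not, at each edge of F in such a way that the resulting trails can be 2-coloured with
-- different colours meeting at every edge of F; this is possible because the constraints form a union
-- of two matchings.  Keep the trails of the colour with more starts.  Since no path edge joins two
-- edges of F, no edge of F and no abandoned path edge joins two of the kept trails, so only the extra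
-- edges of later colours remain.
module Submission where

open import Defs
open import Data.Bool using (Bool; true; false; not; if_then_else_)
open import Data.Bool.Properties using (not-involutive; not-¬)
  renaming (_≟_ to _≟ᵇ_)
open import Data.Empty using (⊥)
open import Data.Fin using (Fin; zero; suc; toℕ)
open import Data.Fin.Properties using (_≟_; any?; all?; injective⇒≤)
import Data.Fin.Properties as Fin
open import Data.Fin.Subset using (Subset) renaming (_∈_ to _∈ₛ_)
open import Data.List using
  (List; []; _∷_; _++_; length; lookup; map; concat; filter; allFin; cartesianProduct)
open import Data.List.Membership.Propositional using (_∈_; _∉_; find; lose)
open import Data.List.Membership.Propositional.Properties using
  (∈-filter⁺; ∈-filter⁻; ∈-cartesianProduct⁺; ∈-allFin; ∈-concat⁺′; ∈-map⁺; ∈-lookup)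
open import Data.List.Relation.Unary.All as All using (All; []; _∷_)
import Data.List.Relation.Unary.All.Properties as All
open import Data.List.Relation.Unary.AllPairs as AllPairs using (AllPairs; []; _∷_)
import Data.List.Relation.Unary.AllPairs.Properties as AllPairs
open import Data.List.Relation.Unary.Any as Any using (here; there)
open import Data.List.Relation.Unary.Linked using (Linked; []; [-]; _∷_)
open import Data.List.Relation.Unary.Unique.Propositional using (Unique)
import Data.List.Relation.Unary.Unique.Propositional.Properties as Unique
open import Data.Nat using (ℕ; zero; suc; _≤_; _<_; _+_; _*_; z≤n)
import Data.Nat.Properties as ℕ
open import Data.Product using (Σ; ∃-syntax; _×_; _,_; proj₁; proj₂; uncurry)
open import Data.Product.Properties using (≡-dec)
open import Data.Sum using (_⊎_; inj₁; inj₂; [_,_]′; swap)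
open import Function using (_∘_)
open import Relation.Binary.Definitions using (DecidableEquality)
open import Relation.Binary.PropositionalEquality
open import Relation.Nullary using (¬_; Dec; yes; no; does; contradiction)
open import Relation.Nullary.Decidable using
  (_×-dec_; _⊎-dec_; ¬?; map′; dec-true; dec-false; from-yes)

-- Two-colouring the union of two matchings.

module TwoColouring {N : Set} (_≟ₙ_ : DecidableEquality N) where

  transpose : N → N → N → N
  transpose p q z = if does (z ≟ₙ p) then q else if does (z ≟ₙ q) then p else z

  transpose-fix : ∀ {p q z} → z ≢ p → z ≢ q → transpose p q z ≡ z
  transpose-fix {p} {q} {z} z≢p z≢q
    rewrite dec-false (z ≟ₙ p) z≢p | dec-false (z ≟ₙ q) z≢q = refl

  transpose-left : ∀ p q → transpose p q p ≡ q
  transpose-left p q rewrite dec-true (p ≟ₙ p) refl = refl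

  transpose-right : ∀ p q → transpose p q q ≡ p
  transpose-right p q with q ≟ₙ p
  ... | yes q≡p = q≡p
  ... | no _ rewrite dec-true (q ≟ₙ q) refl = refl

  transpose-involutive : ∀ p q z → transpose p q (transpose p q z) ≡ z
  transpose-involutive p q z with z ≟ₙ p
  ... | yes refl = transpose-right p q
  ... | no z≢p with z ≟ₙ q
  ...   | yes refl = transpose-left p q
  ...   | no z≢q = transpose-fix z≢p z≢q

  module _ (R : N → N → Set)
           (functional : ∀ {x y y′} → R x y → R x y′ → y ≡ y′)
           (injective : ∀ {x x′ y} → R x y → R x′ y → x ≡ x′)
           (acyclic : ∀ {x y z} → R x y → ¬ R y z) where

    Opposite : (N → Bool) → N × N → Set
    Opposite f (x , y) = f x ≡ not (f y)

    -- The pair (x , y) is removed from as by conjugating b with a transposition, so that x and y,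
    -- as well as b x and b y, become partners; afterwards only x and y must be recoloured.
    two-colourable : (as : List (N × N)) → Unique as → All (uncurry R) as →
      (b : N → N) → (∀ z → b (b z) ≡ z) →
      (f₀ : N → Bool) → (∀ z → f₀ (b z) ≡ not (f₀ z)) →
      Σ (N → Bool) λ f → (∀ z → f (b z) ≡ not (f z)) × All (Opposite f) as
    two-colourable [] _ _ b _ f₀ f₀-proper = f₀ , f₀-proper , []
    two-colourable ((x , y) ∷ as) (xy∉as ∷ unique) (Rxy ∷ Ras) b b-inv f₀ f₀-proper with b x ≟ₙ y
    ... | yes refl =
      let (f , f-proper , f-as) = two-colourable as unique Ras b b-inv f₀ f₀-proper
      in f , f-proper , trans (sym (not-involutive (f x))) (cong not (sym (f-proper x))) ∷ f-as
    ... | no bx≢y = f , f-proper , f-xy ∷ All.tabulate f-as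
      where
      x≢y : x ≢ y
      x≢y refl = acyclic Rxy Rxy

      -- The initial colouring `f₀` certifies that `b` has no fixed points; this is why it is
      -- carried through the recursion.
      bz≢z : ∀ z → b z ≢ z
      bz≢z z bz≡z = not-¬ refl (trans (cong f₀ (sym bz≡z)) (f₀-proper z))

      b-injective : ∀ {z w} → b z ≡ b w → z ≡ w
      b-injective {z} {w} eq = trans (sym (b-inv z)) (trans (cong b eq) (b-inv w))

      by≢x : b y ≢ x
      by≢x by≡x = bx≢y (trans (cong b (sym by≡x)) (b-inv y))

      τ : N → N
      τ = transpose y (b x)

      b′ : N → N
      b′ = τ ∘ b ∘ τ

      b′-inv : ∀ z → b′ (b′ z) ≡ z
      b′-inv z = trans (cong (τ ∘ b) (transpose-involutive y (b x) (b (τ z))))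
                (trans (cong τ (b-inv (τ z))) (transpose-involutive y (b x) z))

      ih : Σ (N → Bool) λ f → (∀ z → f (b′ z) ≡ not (f z)) × All (Opposite f) as
      ih = two-colourable as unique Ras b′ b′-inv (f₀ ∘ τ)
             λ z → trans (cong f₀ (transpose-involutive y (b x) (b (τ z)))) (f₀-proper (τ z))

      f′ : N → Bool
      f′ = proj₁ ih

      -- The vertices `b x` and `b y` differ under `f′`. Giving `x` and `y` the colours opposite to
      -- these makes `x` and `y` differ as well.
      f′-partners : f′ (b y) ≡ not (f′ (b x))
      f′-partners = trans (cong f′ (sym eq)) (proj₁ (proj₂ ih) (b x))
        where
        eq : b′ (b x) ≡ b y
        eq rewrite transpose-right y (b x) = transpose-fix (bz≢z y) (x≢y ∘ sym ∘ b-injective)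

      f : N → Bool
      f z = if does (z ≟ₙ x) then not (f′ (b x)) else if does (z ≟ₙ y) then not (f′ (b y)) else f′ z

      f-x : f x ≡ not (f′ (b x))
      f-x rewrite dec-true (x ≟ₙ x) refl = refl

      f-y : f y ≡ not (f′ (b y))
      f-y rewrite dec-false (y ≟ₙ x) (x≢y ∘ sym) | dec-true (y ≟ₙ y) refl = refl

      f-other : ∀ {z} → z ≢ x → z ≢ y → f z ≡ f′ z
      f-other {z} z≢x z≢y rewrite dec-false (z ≟ₙ x) z≢x | dec-false (z ≟ₙ y) z≢y = refl

      f-xy : f x ≡ not (f y)
      f-xy rewrite f-x | f-y | f′-partners = cong not (sym (not-involutive (f′ (b x))))

      f-bx : f (b x) ≡ not (f x)
      f-bx rewrite f-x | f-other (bz≢z x) bx≢y = sym (not-involutive (f′ (b x)))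

      f-by : f (b y) ≡ not (f y)
      f-by rewrite f-y | f-other by≢x (bz≢z y) = sym (not-involutive (f′ (b y)))

      back : ∀ {z w} → b z ≡ w → f (b w) ≡ not (f w) → f (b z) ≡ not (f z)
      back {z} refl h rewrite b-inv z = trans (sym (not-involutive (f (b z)))) (cong not (sym h))

      f-proper-by : ∀ z → Dec (z ≡ x) → Dec (z ≡ y) → Dec (b z ≡ x) → Dec (b z ≡ y) →
        f (b z) ≡ not (f z)
      f-proper-by z (yes refl) _ _ _ = f-bx
      f-proper-by z (no _) (yes refl) _ _ = f-by
      f-proper-by z (no _) (no _) (yes bz≡x) _ = back bz≡x f-bx
      f-proper-by z (no _) (no _) (no _) (yes bz≡y) = back bz≡y f-by
      f-proper-by z (no z≢x) (no z≢y) (no bz≢x) (no bz≢y) =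
        trans (f-other bz≢x bz≢y)
        (trans (cong f′ (sym b′z≡bz))
        (trans (proj₁ (proj₂ ih) z) (cong not (sym (f-other z≢x z≢y)))))
        where
        b′z≡bz : b′ z ≡ b z
        -- Only `y` and `b x` are moved by `τ`, and neither `z` nor `b z` is one of them.
        b′z≡bz rewrite transpose-fix {y} {b x} z≢y (λ z≡bx → bz≢x (trans (cong b z≡bx) (b-inv x)))
          = transpose-fix bz≢y (z≢x ∘ b-injective)

      f-proper : ∀ z → f (b z) ≡ not (f z)
      f-proper z = f-proper-by z (z ≟ₙ x) (z ≟ₙ y) (b z ≟ₙ x) (b z ≟ₙ y)

      -- A pair of `as` avoids both `x` and `y`, so recolouring leaves it alone: sharing a source or
      -- a target would make it a second copy of `(x , y)`, and no target of `R` is also a source.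
      f-as : ∀ {p} → p ∈ as → Opposite f p
      f-as {x′ , y′} p∈as =
        trans (f-other (λ { refl → fresh (cong (x ,_) (functional Rxy Rp)) })
                       (λ { refl → acyclic Rxy Rp }))
        (trans (All.lookup (proj₂ (proj₂ ih)) p∈as)
               (cong not (sym (f-other (λ { refl → acyclic Rp Rxy })
                                       (λ { refl → fresh (cong (_, y) (injective Rxy Rp)) })))))
        where
        Rp : R x′ y′
        Rp = All.lookup Ras p∈as
        fresh : (x , y) ≢ (x′ , y′)
        fresh = All.lookup xy∉as p∈as

-- Counting: one of two colour classes contains half of the elements.

length-filter-split : ∀ {A : Set} (c : A → Bool) (xs : List A) →
  length (filter (λ x → c x ≟ᵇ true) xs) + length (filter (λ x → not (c x) ≟ᵇ true) xs) ≡ length xs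
length-filter-split c [] = refl
length-filter-split c (x ∷ xs) with c x
... | true = cong suc (length-filter-split c xs)
... | false = trans (ℕ.+-suc _ _) (cong suc (length-filter-split c xs))

half≤ : ∀ {k a b} → 2 * k ≤ a + b → k ≤ a ⊎ k ≤ b
half≤ {k} {a} {b} 2k≤a+b with k ℕ.≤? a | k ℕ.≤? b
... | yes k≤a | _ = inj₁ k≤a
... | no _ | yes k≤b = inj₂ k≤b
... | no k≰a | no k≰b = contradiction 2k≤a+b (ℕ.<⇒≱ a+b<2k)
  where
  a+b<2k : a + b < 2 * k
  a+b<2k rewrite ℕ.+-identityʳ k = ℕ.+-mono-< (ℕ.≰⇒> k≰a) (ℕ.≰⇒> k≰b)

true≢false : ∀ {b} → b ≡ true → b ≢ false
true≢false refl ()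

-- Removing one colour of extra edges by rerouting the paths.

module Rounds {n : ℕ} (Adj Arc₀ : Fin n → Fin n → Set) (X Y : Fin n → Set)
  (m : Fin n → Fin n) (col : Fin n → ℕ)
  (m-involutive : ∀ v → m (m v) ≡ v)
  (m-adj : ∀ {v} → m v ≢ v → Adj v (m v))
  (Adj-m : ∀ {v} → Adj v (m v) → m v ≢ v)
  (col-m : ∀ {v} → m v ≢ v → col (m v) ≡ col v)
  (col-Arc₀ : ∀ {u v} → Arc₀ u v → m u ≢ u → m v ≢ v → col u ≢ col v) where

  private V = Fin n

  -- A family of disjoint X-Y-paths, and possibly some disjoint cycles, given by its vertex set W and
  -- its successor relation arc.  All extra edges left inside W have a colour at least i.
  record System (i : ℕ) : Set₁ where
    field
      W           : V → Set
      W?          : ∀ v → Dec (W v)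
      arc         : V → V → Set
      arc?        : ∀ u v → Dec (arc u v)
      arc-W       : ∀ {u v} → arc u v → W u × W v
      arc-adj     : ∀ {u v} → arc u v → Adj u v
      functional  : ∀ {u v v′} → arc u v → arc u v′ → v ≡ v′
      injective   : ∀ {u u′ v} → arc u v → arc u′ v → u ≡ u′
      arc-origin  : ∀ {u v} → arc u v → Arc₀ u v ⊎ (m u ≡ v × col u < i)
      edges       : ∀ {u v} → W u → W v → Adj u v → arc u v ⊎ arc v u ⊎ (m u ≡ v × i ≤ col u)
      end∈Y       : ∀ {v} → W v → (∀ u → ¬ arc v u) → Y v
      starts      : List V
      unique      : Unique starts
      start-props : All (λ s → W s × X s × (∀ u → ¬ arc u s)) starts

  module _ {i : ℕ} (S : System i) where
    open System S

    -- The current edges are encoded by their ends; the edge at `v` is recovered as `v` together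
    -- with `m v`.
    F : V → Set
    F v = W v × W (m v) × m v ≢ v × col v ≡ i

    F? : ∀ v → Dec (F v)
    F? v = W? v ×-dec W? (m v) ×-dec ¬? (m v ≟ v) ×-dec (col v ℕ.≟ i)

    F-m : ∀ {v} → F v → F (m v)
    F-m {v} (w , w′ , mv≢v , col≡i) =
      w′ , subst W (sym (m-involutive v)) w ,
      (λ eq → mv≢v (trans (sym eq) (m-involutive v))) , trans (col-m mv≢v) col≡i

    -- An original arc joins ends of different colours because the colouring is proper along the
    -- given paths. An arc added in an earlier round has a smaller colour than `i`.
    F-spaced : ∀ {u v} → arc u v → F u → ¬ F v
    F-spaced a (_ , _ , mu≢u , cu) (_ , _ , mv≢v , cv) with arc-origin a
    ... | inj₁ a₀ = col-Arc₀ a₀ mu≢u mv≢v (trans cu (sym cv))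
    ... | inj₂ (_ , cu<i) = ℕ.<⇒≢ cu<i cu

    -- The two functions colour the trail entering and the trail leaving a vertex. Where they differ
    -- at `v`, the trails cross over: the one entering `v` moves along the extra edge and leaves
    -- from `m v`.
    record TrailColouring : Set where
      field
        cin cout : V → Bool
        off-F    : ∀ {v} → ¬ F v → cin v ≡ cout v
        cin-F    : ∀ {v} → F v → cin (m v) ≡ not (cin v)
        cout-F   : ∀ {v} → F v → cout (m v) ≡ not (cout v)
        on-arc   : ∀ {u v} → arc u v → cout u ≡ cin v

    complement : TrailColouring → TrailColouring
    complement c = record
      { cin = not ∘ cin ; cout = not ∘ cout
      ; off-F = cong not ∘ off-F ; cin-F = cong not ∘ cin-F ; cout-F = cong not ∘ cout-F
      ; on-arc = cong not ∘ on-arc }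
      where open TrailColouring c

    -- (v , true) and (v , false) are the two sides of v at which trails enter and leave v.  Negating
    -- the colours of the leaving sides makes each constraint an inequality.
    trailColouring : TrailColouring
    trailColouring = record
      { cin = λ v → f (v , true) ; cout = λ v → not (f (v , false))
      ; off-F = off ; cin-F = λ F-v → on-F F-v true
      ; cout-F = λ F-v → cong not (on-F F-v false)
      ; on-arc = λ {u} {v} a → trans (cong not (opposite a)) (not-involutive _) }
      where
      Side = V × Bool

      R : Side → Side → Set
      R (u , s) (v , t) = s ≡ false × t ≡ true × arc u v

      R? : ∀ p → Dec (uncurry R p)
      R? ((u , s) , (v , t)) = (s ≟ᵇ false) ×-dec (t ≟ᵇ true) ×-dec arc? u v

      sides : List Side
      sides = cartesianProduct (allFin n) (true ∷ false ∷ [])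

      as : List (Side × Side)
      as = filter R? (cartesianProduct sides sides)

      bools-unique : Unique (true ∷ false ∷ [])
      bools-unique = ((λ ()) ∷ []) ∷ [] ∷ []

      sides-unique : Unique sides
      sides-unique = Unique.cartesianProduct⁺ (Unique.allFin⁺ n) bools-unique

      ∈-sides : ∀ v s → (v , s) ∈ sides
      ∈-sides v true = ∈-cartesianProduct⁺ (∈-allFin v) (here refl)
      ∈-sides v false = ∈-cartesianProduct⁺ (∈-allFin v) (there (here refl))

      -- At an end of an `F`-edge the partner is the same side of the other end, which encodes
      -- `cin-F` and `cout-F`; elsewhere it is the other side of the same vertex, which encodes
      -- `off-F`.
      b : Side → Side
      b (v , s) with F? v
      ... | yes _ = m v , s
      ... | no _ = v , not s

      b-yes : ∀ {v} s → F v → b (v , s) ≡ (m v , s)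
      b-yes {v} s F-v with F? v
      ... | yes _ = refl
      ... | no ¬F = contradiction F-v ¬F

      b-no : ∀ {v} s → ¬ F v → b (v , s) ≡ (v , not s)
      b-no {v} s ¬F with F? v
      ... | yes F-v = contradiction F-v ¬F
      ... | no _ = refl

      b-involutive : ∀ z → b (b z) ≡ z
      b-involutive (v , s) with F? v
      ... | yes F-v = trans (b-yes s (F-m F-v)) (cong (_, s) (m-involutive v))
      ... | no ¬F = trans (b-no (not s) ¬F) (cong (v ,_) (not-involutive s))

      -- The order on `Fin n` tells the two ends of an extra edge apart. Combined with the side of a
      -- vertex outside `F`, it yields `f₀`, which is proper for `b` alone.
      below : V → Bool
      below v = does (v Fin.<? m v)

      below-m : ∀ {v} → m v ≢ v → below (m v) ≡ not (below v)
      below-m {v} mv≢v rewrite m-involutive v with v Fin.<? m v | m v Fin.<? v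
      ... | yes v<mv | yes mv<v = contradiction mv<v (ℕ.<⇒≯ v<mv)
      ... | yes v<mv | no mv≮v =
        trans (dec-false (m v Fin.<? v) mv≮v) (cong not (sym (dec-true (v Fin.<? m v) v<mv)))
      ... | no v≮mv | yes mv<v =
        trans (dec-true (m v Fin.<? v) mv<v) (cong not (sym (dec-false (v Fin.<? m v) v≮mv)))
      ... | no v≮mv | no mv≮v =
        contradiction (Fin.toℕ-injective (ℕ.≤-antisym (ℕ.≮⇒≥ v≮mv) (ℕ.≮⇒≥ mv≮v))) mv≢v

      f₀ : Side → Bool
      f₀ (v , s) with F? v
      ... | yes _ = below v
      ... | no _ = s

      f₀-yes : ∀ {v} s → F v → f₀ (v , s) ≡ below v
      f₀-yes {v} s F-v with F? v
      ... | yes _ = refl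
      ... | no ¬F = contradiction F-v ¬F

      f₀-no : ∀ {v} s → ¬ F v → f₀ (v , s) ≡ s
      f₀-no {v} s ¬F with F? v
      ... | yes F-v = contradiction F-v ¬F
      ... | no _ = refl

      f₀-proper : ∀ z → f₀ (b z) ≡ not (f₀ z)
      f₀-proper (v , s) with F? v
      ... | yes F-v@(_ , _ , mv≢v , _) = trans (f₀-yes s (F-m F-v)) (below-m mv≢v)
      ... | no ¬F = f₀-no (not s) ¬F

      open TwoColouring (≡-dec _≟_ _≟ᵇ_)

      colouring : Σ (Side → Bool) λ f → (∀ z → f (b z) ≡ not (f z)) ×
        All (λ p → f (proj₁ p) ≡ not (f (proj₂ p))) as
      colouring = two-colourable R
        (λ { (refl , refl , a) (_ , refl , a′) → cong (_, true) (functional a a′) })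
        (λ { (refl , refl , a) (refl , _ , a′) → cong (_, false) (injective a a′) })
        -- Targets of `R` are entering sides and sources are leaving sides.
        (λ { (_ , refl , _) (() , _) })
        as (Unique.filter⁺ R? (Unique.cartesianProduct⁺ sides-unique sides-unique))
        (All.all-filter R? (cartesianProduct sides sides))
        b b-involutive f₀ f₀-proper

      f : Side → Bool
      f = proj₁ colouring

      opposite : ∀ {u v} → arc u v → f (u , false) ≡ not (f (v , true))
      opposite a = All.lookup (proj₂ (proj₂ colouring))
        (∈-filter⁺ R? (∈-cartesianProduct⁺ (∈-sides _ false) (∈-sides _ true)) (refl , refl , a))

      off : ∀ {v} → ¬ F v → f (v , true) ≡ not (f (v , false))
      off {v} ¬F = trans (cong f (sym (b-no false ¬F))) (proj₁ (proj₂ colouring) (v , false))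

      on-F : ∀ {v} → F v → ∀ s → f (m v , s) ≡ not (f (v , s))
      on-F F-v s = trans (cong f (sym (b-yes s F-v))) (proj₁ (proj₂ colouring) _)

    module _ (c : TrailColouring) where
      open TrailColouring c

      W⁺ : V → Set
      W⁺ v = W v × (cin v ≡ true ⊎ cout v ≡ true)

      -- The first case continues along an old arc, possibly right after a crossing. The second is
      -- the crossing itself, taken where a kept trail enters `u` but does not leave from it.
      arc⁺ : V → V → Set
      arc⁺ u v = (cout u ≡ true × arc u v) ⊎ (F u × cin u ≡ true × cout u ≡ false × m u ≡ v)

      crossing : ∀ {v} → cin v ≡ true → cout v ≡ false → F v
      crossing {v} in-true out-false with F? v
      ... | yes F-v = F-v
      ... | no ¬F = contradiction (trans (sym (off-F ¬F)) in-true) (λ h → true≢false h out-false)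

      crossing′ : ∀ {v} → cin v ≡ false → cout v ≡ true → F v
      crossing′ {v} in-false out-true with F? v
      ... | yes F-v = F-v
      ... | no ¬F = contradiction (trans (off-F ¬F) out-true) (λ h → true≢false h in-false)

      -- Entering colours are opposite at the two ends of an `F`-edge, so a trail that crosses to
      -- `v` meets no kept trail coming in or starting at `v`.
      no-merge : ∀ {u v} → F u → cin u ≡ true → m u ≡ v → cin v ≢ true
      no-merge F-u in-true refl h =
        true≢false h (trans (cin-F F-u) (cong not in-true))

      round-edges : ∀ {u v} → W⁺ u → W⁺ v → Adj u v →
        arc⁺ u v ⊎ arc⁺ v u ⊎ (m u ≡ v × suc i ≤ col u)
      round-edges {u} {v} (w-u , t-u) (w-v , t-v) adj = by-edge (edges w-u w-v adj)
        where
        -- If the arc were abandoned, the trail leaving `x` and entering `y` would have colour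
        -- `false`. As both vertices are kept, the colours would change at `x` and at `y`, so both
        -- would be ends of `F`-edges, against `F-spaced`.
        keep : ∀ {x y} → cin x ≡ true ⊎ cout x ≡ true → cin y ≡ true ⊎ cout y ≡ true →
          arc x y → arc⁺ x y
        keep {x} {y} t-x t-y a with cout x in out-x
        ... | true = inj₁ (refl , a)
        ... | false = contradiction (F-x t-x) (λ F-x → F-spaced a F-x (F-y t-y))
          where
          in-y : cin y ≡ false
          in-y = trans (sym (on-arc a)) out-x
          F-x : cin x ≡ true ⊎ false ≡ true → F x
          F-x (inj₁ in-x) = crossing in-x out-x
          F-y : cin y ≡ true ⊎ cout y ≡ true → F y
          F-y (inj₁ h) = contradiction in-y (true≢false h)
          F-y (inj₂ h) = crossing′ in-y h

        -- Leaving colours are opposite at the two ends, so exactly one end is not left with colour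
        -- `true`. Being kept, that end is entered with colour `true`, and the trail crosses from
        -- there.
        across : ∀ {x y} → F x → m x ≡ y → cin x ≡ true ⊎ cout x ≡ true →
          cin y ≡ true ⊎ cout y ≡ true → arc⁺ x y ⊎ arc⁺ y x
        across {x} F-x refl t-x t-y with cout x in out-x
        across F-x refl (inj₁ in-x) t-y | false = inj₁ (inj₂ (F-x , in-x , refl , refl))
        across {x} F-x refl t-x t-y | true = inj₂ (inj₂ (F-m F-x , in-y t-y , out-y , m-involutive _))
          where
          out-y : cout (m x) ≡ false
          out-y = trans (cout-F F-x) (cong not out-x)
          in-y : cin (m x) ≡ true ⊎ cout (m x) ≡ true → cin (m x) ≡ true
          in-y (inj₁ h) = h
          in-y (inj₂ h) = contradiction out-y (true≢false h)

        by-edge : arc u v ⊎ arc v u ⊎ (m u ≡ v × i ≤ col u) →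
          arc⁺ u v ⊎ arc⁺ v u ⊎ (m u ≡ v × suc i ≤ col u)
        by-edge (inj₁ a) = inj₁ (keep t-u t-v a)
        by-edge (inj₂ (inj₁ a)) = inj₂ (inj₁ (keep t-v t-u a))
        by-edge (inj₂ (inj₂ (refl , i≤col))) with col u ℕ.≟ i
        ... | yes col≡i with across (w-u , w-v , Adj-m adj , col≡i) refl t-u t-v
        ...   | inj₁ a = inj₁ a
        ...   | inj₂ a = inj₂ (inj₁ a)
        by-edge (inj₂ (inj₂ (refl , i≤col))) | no col≢i =
          inj₂ (inj₂ (refl , ℕ.≤∧≢⇒< i≤col (col≢i ∘ sym)))

      round : System (suc i)
      round = record
        { W = W⁺
        ; W? = λ v → W? v ×-dec ((cin v ≟ᵇ true) ⊎-dec (cout v ≟ᵇ true))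
        ; arc = arc⁺
        ; arc? = λ u v → ((cout u ≟ᵇ true) ×-dec arc? u v) ⊎-dec
            (F? u ×-dec (cin u ≟ᵇ true) ×-dec (cout u ≟ᵇ false) ×-dec (m u ≟ v))
        ; arc-W = λ
            { (inj₁ (t , a)) → (proj₁ (arc-W a) , inj₂ t) ,
                               (proj₂ (arc-W a) , inj₁ (trans (sym (on-arc a)) t))
            ; (inj₂ (F-u , t , t′ , refl)) → (proj₁ F-u , inj₁ t) ,
                (proj₁ (proj₂ F-u) , inj₂ (trans (cout-F F-u) (cong not t′))) }
        ; arc-adj = λ
            { (inj₁ (_ , a)) → arc-adj a
            ; (inj₂ ((_ , _ , mu≢u , _) , _ , _ , refl)) → m-adj mu≢u }
        ; functional = λ
            { (inj₁ (_ , a)) (inj₁ (_ , a′)) → functional a a′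
            ; (inj₁ (t , _)) (inj₂ (_ , _ , t′ , _)) → contradiction t′ (true≢false t)
            ; (inj₂ (_ , _ , t′ , _)) (inj₁ (t , _)) → contradiction t′ (true≢false t)
            ; (inj₂ (_ , _ , _ , refl)) (inj₂ (_ , _ , _ , refl)) → refl }
        ; injective = λ
            { (inj₁ (_ , a)) (inj₁ (_ , a′)) → injective a a′
            ; (inj₁ (t , a)) (inj₂ (F-u , t′ , _ , eq)) →
                contradiction (trans (sym (on-arc a)) t) (no-merge F-u t′ eq)
            ; (inj₂ (F-u , t′ , _ , eq)) (inj₁ (t , a)) →
                contradiction (trans (sym (on-arc a)) t) (no-merge F-u t′ eq)
            ; (inj₂ (_ , _ , _ , refl)) (inj₂ (_ , _ , _ , eq)) →
                trans (sym (m-involutive _)) (trans (cong m (sym eq)) (m-involutive _)) }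
        ; arc-origin = λ
            { (inj₁ (_ , a)) →
                [ inj₁ , (λ { (eq , lt) → inj₂ (eq , ℕ.m<n⇒m<1+n lt) }) ]′ (arc-origin a)
            ; (inj₂ ((_ , _ , _ , refl) , _ , _ , eq)) → inj₂ (eq , ℕ.n<1+n _) }
        ; edges = round-edges
        ; end∈Y = round-end
        -- No arc enters a start, and its `cin` is read as the colour of the trail that begins
        -- there. `cout` would be wrong, since the trail may cross over at its very first vertex.
        ; starts = filter red? starts
        ; unique = Unique.filter⁺ red? unique
        ; start-props = All.tabulate round-start }
        where
        red? : ∀ v → Dec (cin v ≡ true)
        red? v = cin v ≟ᵇ true

        -- If `cout v` were `false`, the kept vertex `v` would have a crossing as its successor.
        -- Hence every old arc out of `v` survives, and a new end is an old end.
        round-end : ∀ {v} → W⁺ v → (∀ u → ¬ arc⁺ v u) → Y v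
        round-end {v} (w , t) none with cout v in out-v
        ... | true = end∈Y w (λ u a → none u (inj₁ (refl , a)))
        round-end {v} (w , inj₁ in-v) none | false =
          contradiction (inj₂ (crossing in-v out-v , in-v , refl , refl)) (none (m v))

        round-start : ∀ {s} → s ∈ filter red? starts → W⁺ s × X s × (∀ u → ¬ arc⁺ u s)
        round-start s∈ with ∈-filter⁻ red? s∈
        ... | s∈starts , in-s with All.lookup start-props s∈starts
        ...   | w , x , none = (w , inj₁ in-s) , x , λ
          { u (inj₁ (_ , a)) → none u a
          ; u (inj₂ (F-u , t , _ , eq)) → no-merge F-u t eq in-s }

    -- Every start survives under exactly one of the colouring and its complement. The second filter
    -- of `length-filter-split` uses `not` so that it is literally the list of starts for the
    -- complement.
    halve : ∀ k → 2 * k ≤ length starts → Σ (System (suc i)) λ S′ → k ≤ length (System.starts S′)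
    halve k 2k≤
      with half≤ (subst (2 * k ≤_)
             (sym (length-filter-split (TrailColouring.cin trailColouring) starts)) 2k≤)
    ... | inj₁ k≤ = round trailColouring , k≤
    ... | inj₂ k≤ = round (complement trailColouring) , k≤

-- Consecutive vertices of a list, and four-colouring the extra edges.

avoid-three : (a b c : Fin 4) → ∃[ d ] (d ≢ a × d ≢ b × d ≢ c)
avoid-three = from-yes (all? {4} λ a → all? {4} λ b → all? {4} λ c →
  any? {4} λ d → ¬? (d ≟ a) ×-dec ¬? (d ≟ b) ×-dec ¬? (d ≟ c))

module _ (G : Graph) where
  open Graph G using (n)

  private V = Fin n

  _∈?_ : ∀ v (l : List V) → Dec (v ∈ l)
  v ∈? l = Any.any? (v ≟_) l

  unique-head : ∀ {x : V} {l} → Unique (x ∷ l) → x ∉ l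
  unique-head (x∉l ∷ _) x∈l = All.lookup x∉l x∈l refl

  consec? : ∀ l u v → Dec (Consec G l u v)
  consec? [] u v = no λ ()
  consec? (x ∷ []) u v = no λ { (there ()) }
  consec? (x ∷ y ∷ l) u v with (x ≟ u) ×-dec (y ≟ v) | consec? (y ∷ l) u v
  ... | yes (refl , refl) | _ = yes here
  ... | no _ | yes c = yes (there c)
  ... | no ¬h | no ¬c = no λ { here → ¬h (refl , refl) ; (there c) → ¬c c }

  consec-∈ˡ : ∀ {l u v} → Consec G l u v → u ∈ l
  consec-∈ˡ here = here refl
  consec-∈ˡ (there c) = there (consec-∈ˡ c)

  consec-∈ʳ : ∀ {x l u v} → Consec G (x ∷ l) u v → v ∈ l
  consec-∈ʳ here = here refl
  consec-∈ʳ {l = _ ∷ _} (there c) = there (consec-∈ʳ c)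

  consec-∈ : ∀ {l u v} → Consec G l u v → v ∈ l
  consec-∈ {_ ∷ _} c = there (consec-∈ʳ c)

  consec-irrefl : ∀ {l u} → Unique l → ¬ Consec G l u u
  consec-irrefl unique here = unique-head unique (here refl)
  consec-irrefl (_ ∷ unique) (there c) = consec-irrefl unique c

  consec-functional : ∀ {l u v v′} → Unique l → Consec G l u v → Consec G l u v′ → v ≡ v′
  consec-functional _ here here = refl
  consec-functional unique here (there c) = contradiction (consec-∈ˡ c) (unique-head unique)
  consec-functional unique (there c) here = contradiction (consec-∈ˡ c) (unique-head unique)
  consec-functional (_ ∷ unique) (there c) (there c′) = consec-functional unique c c′

  consec-injective : ∀ {l u u′ v} → Unique l → Consec G l u v → Consec G l u′ v → u ≡ u′
  consec-injective _ here here = refl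
  consec-injective (_ ∷ unique) here (there c) = contradiction (consec-∈ʳ c) (unique-head unique)
  consec-injective (_ ∷ unique) (there c) here = contradiction (consec-∈ʳ c) (unique-head unique)
  consec-injective (_ ∷ unique) (there c) (there c′) = consec-injective unique c c′

  -- A vertex without successor gets itself as a default, about which nothing is claimed. The greedy
  -- colouring can thus always name its forbidden colours.
  next : ∀ {l} → Unique l → ∀ u → ∃[ v ] (∀ w → Consec G l u w → w ≡ v)
  next {l} unique u with any? (consec? l u)
  ... | yes (v , c) = v , λ w c′ → consec-functional unique c′ c
  ... | no ¬c = u , λ w c → contradiction (w , c) ¬c

  previous : ∀ {l} → Unique l → ∀ v → ∃[ u ] (∀ w → Consec G l w v → w ≡ u)
  previous {l} unique v with any? (λ u → consec? l u v)
  ... | yes (u , c) = u , λ w c′ → consec-injective unique c′ c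
  ... | no ¬c = v , λ w c → contradiction (w , c) ¬c

  firstV-∈ : ∀ {l d} → l ≢ [] → firstV G d l ∈ l
  firstV-∈ {[]} l≢[] = contradiction refl l≢[]
  firstV-∈ {_ ∷ _} _ = here refl

  lastV-∈ : ∀ {l d} → l ≢ [] → lastV G d l ∈ l
  lastV-∈ {[]} l≢[] = contradiction refl l≢[]
  lastV-∈ {x ∷ []} _ = here refl
  lastV-∈ {x ∷ y ∷ l} _ = there (lastV-∈ {y ∷ l} {x} λ ())

  firstV-no-previous : ∀ {l d u} → Unique l → ¬ Consec G l u (firstV G d l)
  firstV-no-previous {_ ∷ _} unique c = unique-head unique (consec-∈ʳ c)

  lastV-no-next : ∀ {l d u} → Unique l → ¬ Consec G l (lastV G d l) u
  lastV-no-next {x ∷ y ∷ l} {d} unique c with lastV G d (x ∷ y ∷ l) in eq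
  lastV-no-next {x ∷ y ∷ l} unique here | _ =
    unique-head unique (subst (_∈ y ∷ l) eq (lastV-∈ {y ∷ l} {x} λ ()))
  lastV-no-next {x ∷ y ∷ l} (_ ∷ unique) (there c) | _ =
    lastV-no-next {y ∷ l} {x} unique (subst (λ w → Consec G (y ∷ l) w _) (sym eq) c)
  lastV-no-next {x ∷ []} unique (there ())

  has-previous : ∀ {x l v} → v ∈ l → ∃[ u ] Consec G (x ∷ l) u v
  has-previous (here refl) = _ , here
  has-previous (there v∈l) = let (u , c) = has-previous v∈l in u , there c

  no-previous⇒firstV : ∀ {l d v} → v ∈ l → (∀ u → ¬ Consec G l u v) → v ≡ firstV G d l
  no-previous⇒firstV (here refl) _ = refl
  no-previous⇒firstV (there v∈l) none = let (u , c) = has-previous v∈l in contradiction c (none u)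

  no-next⇒lastV : ∀ {l d v} → v ∈ l → (∀ u → ¬ Consec G l v u) → v ≡ lastV G d l
  no-next⇒lastV {x ∷ []} (here refl) _ = refl
  no-next⇒lastV {x ∷ y ∷ l} (here refl) none = contradiction here (none y)
  no-next⇒lastV {x ∷ y ∷ l} (there v∈l) none = no-next⇒lastV {d = x} v∈l (λ u → none u ∘ there)

  module FourColouring (m : V → V) (m-involutive : ∀ v → m (m v) ≡ v) where

    -- An extra edge counts as coloured only once both of its ends lie in the suffix `l` treated so
    -- far.
    Ready : List V → V → Set
    Ready l v = v ∈ l × m v ∈ l × m v ≢ v

    ready-tail : ∀ {x l v} → v ≢ x → m v ≢ x → Ready (x ∷ l) v → Ready l v
    ready-tail v≢x mv≢x (v∈ , mv∈ , mv≢v) = Any.tail v≢x v∈ , Any.tail mv≢x mv∈ , mv≢v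

    -- Greedy colouring from the back of l: when the pair {x , m x} is coloured, only the neighbour
    -- behind x and the two neighbours of m x can already have a colour.
    four-colouring : ∀ {l} → Unique l → Σ (V → Fin 4) λ col →
      (∀ {v} → Ready l v → col (m v) ≡ col v) ×
      (∀ {u v} → Consec G l u v → Ready l u → Ready l v → m u ≢ v → col u ≢ col v)
    four-colouring {[]} [] = (λ _ → zero) , (λ _ → refl) , λ ()
    four-colouring {x ∷ l} unique@(x∉l ∷ unique-l)
      with four-colouring unique-l | m x ∈? l
    -- No edge becomes ready when `x` is added, so the old colouring is kept.
    ... | col , col-m , col-consec | no mx∉l =
      col , (λ r → col-m (skip r)) ,
      λ { here (_ , mx∈ , mx≢x) _ _ → contradiction (Any.tail mx≢x mx∈) mx∉l
        ; (there c) r r′ → col-consec c (skip r) (skip r′) }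
      where
      skip : ∀ {v} → Ready (x ∷ l) v → Ready l v
      skip {v} r@(v∈ , mv∈ , mv≢v) = ready-tail v≢x mv≢x r
        where
        v≢x : v ≢ x
        v≢x refl = mx∉l (Any.tail mv≢v mv∈)
        mv≢x : m v ≢ x
        mv≢x refl = mx∉l (subst (_∈ l) (sym (m-involutive v)) (Any.tail v≢x v∈))
    ... | col , col-m , col-consec | yes mx∈l = col′ , col′-m , col′-consec
      where
      y : V
      y = m x

      q : ∃[ v ] (∀ w → Consec G l y w → w ≡ v)
      q = next unique-l y

      p : ∃[ u ] (∀ w → Consec G l w y → w ≡ u)
      p = previous unique-l y

      fresh : ∃[ d ] (d ≢ col (firstV G x l) × d ≢ col (proj₁ p) × d ≢ col (proj₁ q))
      fresh = avoid-three (col (firstV G x l)) (col (proj₁ p)) (col (proj₁ q))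

      c : Fin 4
      c = proj₁ fresh

      col′ : V → Fin 4
      col′ v = if does ((v ≟ x) ⊎-dec (v ≟ y)) then c else col v

      col′-new : ∀ {v} → v ≡ x ⊎ v ≡ y → col′ v ≡ c
      col′-new {v} h rewrite dec-true ((v ≟ x) ⊎-dec (v ≟ y)) h = refl

      col′-old : ∀ {v} → v ≢ x → v ≢ y → col′ v ≡ col v
      col′-old {v} v≢x v≢y
        rewrite dec-false ((v ≟ x) ⊎-dec (v ≟ y)) [ v≢x , v≢y ]′ = refl

      m-flip : ∀ {v w} → m v ≡ w → v ≡ m w
      m-flip {v} refl = sym (m-involutive v)

      ready-old : ∀ {v} → v ≢ x → v ≢ y → Ready (x ∷ l) v → Ready l v
      ready-old v≢x v≢y = ready-tail v≢x (v≢y ∘ m-flip)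

      col′-m-by : ∀ {v} → Ready (x ∷ l) v → Dec (v ≡ x) → Dec (v ≡ y) → col′ (m v) ≡ col′ v
      col′-m-by r (yes refl) _ = trans (col′-new (inj₂ refl)) (sym (col′-new (inj₁ refl)))
      col′-m-by r (no _) (yes refl) =
        trans (col′-new (inj₁ (m-involutive x))) (sym (col′-new (inj₂ refl)))
      col′-m-by r (no v≢x) (no v≢y) =
        trans (col′-old (v≢y ∘ m-flip) (λ mv≡y → v≢x (trans (m-flip mv≡y) (m-involutive x))))
        (trans (col-m (ready-old v≢x v≢y r)) (sym (col′-old v≢x v≢y)))

      col′-m : ∀ {v} → Ready (x ∷ l) v → col′ (m v) ≡ col′ v
      col′-m r = col′-m-by r (_ ≟ x) (_ ≟ y)

      differ : ∀ {u v} → u ≡ x ⊎ u ≡ y → v ≢ x → v ≢ y → c ≢ col v → col′ u ≢ col′ v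
      differ h v≢x v≢y c≢ eq = c≢ (trans (sym (col′-new h)) (trans eq (col′-old v≢x v≢y)))

      ∈⇒≢x : ∀ {v} → v ∈ l → v ≢ x
      ∈⇒≢x v∈l refl = unique-head unique v∈l

      inner : ∀ {u v} → Consec G l u v → Ready (x ∷ l) u → Ready (x ∷ l) v → m u ≢ v →
        Dec (u ≡ y) → Dec (v ≡ y) → col′ u ≢ col′ v
      inner cs r r′ mu≢v (yes refl) (yes refl) = contradiction cs (consec-irrefl unique-l)
      inner cs r r′ mu≢v (yes refl) (no v≢y) =
        differ (inj₂ refl) (∈⇒≢x (consec-∈ cs)) v≢y
          (subst (λ w → c ≢ col w) (sym (proj₂ q _ cs)) (proj₂ (proj₂ (proj₂ fresh))))
      inner cs r r′ mu≢v (no u≢y) (yes refl) =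
        differ (inj₂ refl) (∈⇒≢x (consec-∈ˡ cs)) u≢y
          (subst (λ w → c ≢ col w) (sym (proj₂ p _ cs)) (proj₁ (proj₂ (proj₂ fresh)))) ∘ sym
      inner cs r r′ mu≢v (no u≢y) (no v≢y) eq =
        let u≢x = ∈⇒≢x (consec-∈ˡ cs)
            v≢x = ∈⇒≢x (consec-∈ cs)
        in col-consec cs (ready-old u≢x u≢y r) (ready-old v≢x v≢y r′) mu≢v
             (trans (sym (col′-old u≢x u≢y)) (trans eq (col′-old v≢x v≢y)))

      col′-consec : ∀ {u v} → Consec G (x ∷ l) u v → Ready (x ∷ l) u → Ready (x ∷ l) v → m u ≢ v →
        col′ u ≢ col′ v
      col′-consec here r r′ mx≢v =
        differ (inj₁ refl) (∈⇒≢x (here refl)) (mx≢v ∘ sym) (proj₁ (proj₂ fresh))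
      col′-consec (there cs) r r′ mu≢v = inner cs r r′ mu≢v (_ ≟ y) (_ ≟ y)

-- Following arcs from the starts to obtain paths.

unique⇒length≤ : ∀ {n} {l : List (Fin n)} → Unique l → length l ≤ n
unique⇒length≤ unique = injective⇒≤ (lookup-injective unique)
  where
  lookup-injective : ∀ {A : Set} {l : List A} → Unique l → ∀ {i j} → lookup l i ≡ lookup l j → i ≡ j
  lookup-injective (_ ∷ _) {zero} {zero} _ = refl
  lookup-injective (x∉ ∷ _) {zero} {suc j} eq = contradiction eq (All.lookup x∉ (∈-lookup j))
  lookup-injective (x∉ ∷ _) {suc i} {zero} eq = contradiction (sym eq) (All.lookup x∉ (∈-lookup i))
  lookup-injective (_ ∷ unique) {suc i} {suc j} eq = cong suc (lookup-injective unique eq)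

module Trails (G : Graph) (X Y : Subset (Graph.n G))
  (W : Fin (Graph.n G) → Set) (arc : Fin (Graph.n G) → Fin (Graph.n G) → Set)
  (arc? : ∀ u v → Dec (arc u v))
  (arc-W : ∀ {u v} → arc u v → W v)
  (arc-adj : ∀ {u v} → arc u v → Adj G u v)
  (injective : ∀ {u u′ v} → arc u v → arc u′ v → u ≡ u′)
  (edges : ∀ {u v} → W u → W v → Adj G u v → arc u v ⊎ arc v u)
  (end∈Y : ∀ {v} → W v → (∀ u → ¬ arc v u) → v ∈ₛ Y) where

  private V = Fin (Graph.n G)

  Start : V → Set
  Start s = W s × s ∈ₛ X × (∀ u → ¬ arc u s)

  data Reach (s : V) : V → Set where
    start : Reach s s
    step  : ∀ {u v} → Reach s u → arc u v → Reach s v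

  reach-W : ∀ {s v} → Start s → Reach s v → W v
  reach-W (w , _) start = w
  reach-W _ (step _ a) = arc-W a

  -- Predecessors are unique and starts have none, so tracing back from `v` leads to a single start.
  reach-unique : ∀ {s t v} → Start s → Start t → Reach s v → Reach t v → s ≡ t
  reach-unique _ _ start start = refl
  reach-unique (_ , _ , none) _ start (step _ a) = contradiction a (none _)
  reach-unique _ (_ , _ , none) (step _ a) start = contradiction a (none _)
  reach-unique S T (step r a) (step r′ a′) with injective a a′
  ... | refl = reach-unique S T r r′

  -- The vertices of a trail are listed backwards, from its current end to its start s.
  data Trail (s : V) : List V → Set where
    [-] : Trail s (s ∷ [])
    _∷_ : ∀ {u v vs} → arc v u → Trail s (v ∷ vs) → Trail s (u ∷ v ∷ vs)

  trail-reach : ∀ {s l} → Trail s l → All (Reach s) l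
  trail-reach [-] = start ∷ []
  trail-reach (a ∷ t) with trail-reach t
  ... | r ∷ rs = step r a ∷ r ∷ rs

  trail-linked : ∀ {s l} → Trail s l → Linked (Adj G) l
  trail-linked [-] = [-]
  trail-linked (a ∷ t) = trans (Graph.sym G _ _) (arc-adj a) ∷ trail-linked t

  trail-last : ∀ {s u us} → Trail s (u ∷ us) → lastV G u us ≡ s
  trail-last [-] = refl
  trail-last (_ ∷ t) = trail-last t

  trail-previous : ∀ {s w ws u} → Trail s (w ∷ ws) → u ∈ w ∷ ws → u ≡ s ⊎ ∃[ v ] (v ∈ ws × arc v u)
  trail-previous [-] (here refl) = inj₁ refl
  trail-previous (a ∷ t) (here refl) = inj₂ (_ , here refl , a)
  trail-previous (_ ∷ t) (there u∈) with trail-previous t u∈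
  ... | inj₁ eq = inj₁ eq
  ... | inj₂ (v , v∈ , a) = inj₂ (v , there v∈ , a)

  -- If the new vertex `u` had occurred before, it would be the start, which has no predecessor, or
  -- it would have a predecessor further back in the trail. By injectivity the latter is `v`, which
  -- would then be repeated already. So a walk from a start never closes up into a cycle.
  trail-unique : ∀ {s l} → Start s → Trail s l → Unique l
  trail-unique S [-] = [] ∷ []
  trail-unique {s} S (_∷_ {u} {v} {vs} a t) = All.tabulate fresh ∷ unique
    where
    unique : Unique (v ∷ vs)
    unique = trail-unique S t
    fresh : ∀ {w} → w ∈ v ∷ vs → u ≢ w
    fresh w∈ refl with trail-previous t w∈
    ... | inj₁ refl = proj₂ (proj₂ S) v a
    ... | inj₂ (v′ , v′∈ , a′) with injective a a′
    ...   | refl = unique-head G unique v′∈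

  -- A trail repeats no vertex and so has at most `n` vertices, whereas fuel plus length always
  -- exceeds `n`. The fuel therefore cannot run out.
  complete : ∀ {s} → Start s → ∀ fuel {v vs} → Trail s (v ∷ vs) →
    Graph.n G < fuel + length (v ∷ vs) →
    ∃[ u ] ∃[ us ] (Trail s (u ∷ us) × (∀ w → ¬ arc u w))
  complete S zero t n< = contradiction (unique⇒length≤ (trail-unique S t)) (ℕ.<⇒≱ n<)
  complete S (suc fuel) {v} {vs} t n< with any? (arc? v)
  ... | no none = v , vs , t , λ w a → none (w , a)
  ... | yes (w , a) = complete S fuel (a ∷ t) (subst (Graph.n G <_) (sym (ℕ.+-suc fuel _)) n<)

  trail-path : ∀ {s} → Start s → Σ (Path G) λ Q → IsXYPath G X Y Q × All (Reach s) (verts Q)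
  trail-path {s} S
    with complete S (Graph.n G) [-]
           (subst (Graph.n G <_) (sym (ℕ.+-comm (Graph.n G) 1)) (ℕ.n<1+n _))
  ... | u , us , t , none =
    mkPath (u ∷ us) (λ ()) (trail-unique S t) (trail-linked t) ,
    (u , s , (refl , trail-last t) ,
      -- The list runs from the end in `Y` back to the start in `X`, hence the second orientation.
      inj₂ (proj₁ (proj₂ S) , end∈Y (reach-W S (All.head (trail-reach t))) none)) ,
    trail-reach t

  From : List V → Path G → Set
  From L Q = ∃[ s ] (s ∈ L × Start s × All (Reach s) (verts Q))

  -- Every edge inside `W` is an arc, so an edge between the paths would extend one trail to a
  -- vertex of the other, which would then be reached from two starts.
  reach-nonadjacent : ∀ {s t P Q} → Start s → Start t → s ≢ t →
    All (Reach s) (verts P) → All (Reach t) (verts Q) → NonAdjacent G P Q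
  reach-nonadjacent S T s≢t rP rQ =
    (λ v v∈P v∈Q → s≢t (reach-unique S T (All.lookup rP v∈P) (All.lookup rQ v∈Q))) ,
    λ u v u∈P v∈Q adj → separate (All.lookup rP u∈P) (All.lookup rQ v∈Q) adj
    where
    separate : ∀ {u v} → Reach _ u → Reach _ v → ¬ Adj G u v
    separate r r′ adj with edges (reach-W S r) (reach-W T r′) adj
    ... | inj₁ a = s≢t (reach-unique S T (step r a) r′)
    ... | inj₂ a = s≢t (reach-unique S T r (step r′ a))

  -- The component `From L` strengthens the induction: it remembers the start of each path already
  -- built, for comparison with the start of the next one.
  nonadjacent-paths : ∀ {L} → Unique L → All Start L → Σ (List (Path G)) λ 𝒬 →
    length 𝒬 ≡ length L × All (IsXYPath G X Y) 𝒬 × AllPairs (NonAdjacent G) 𝒬 × All (From L) 𝒬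
  nonadjacent-paths [] [] = [] , refl , [] , [] , []
  nonadjacent-paths (s∉L ∷ unique) (S ∷ Ss)
    with trail-path S | nonadjacent-paths unique Ss
  ... | Q , xy , rQ | 𝒬 , len , xys , nonadj , froms =
    Q ∷ 𝒬 , cong suc len , xy ∷ xys ,
    All.map (λ { {Q′} (t , t∈L , T , rQ′) →
      reach-nonadjacent {P = Q} {Q′} S T (All.lookup s∉L t∈L) rQ rQ′ }) froms ∷ nonadj ,
    (_ , here refl , S , rQ) ∷ All.map (λ { (t , t∈L , T , rQ′) → t , there t∈L , T , rQ′ }) froms

-- Orienting the given paths from `X` to `Y`.

module Orientation (G : Graph) (X Y : Subset (Graph.n G)) where

  private
    V = Fin (Graph.n G)
    XY = IsXYPath G X Y
    variable
      P : Path G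
      𝒫 : List (Path G)
      u u′ v v′ : V

  -- The direction is read off the proof that `P` is an `X`-`Y`-path, since its vertices may be
  -- listed from either end.
  arcOf : XY P → V → V → Set
  arcOf {P} (_ , _ , _ , inj₁ _) u v = Consec G (verts P) u v
  arcOf {P} (_ , _ , _ , inj₂ _) u v = Consec G (verts P) v u

  arcOf? : (p : XY P) → ∀ u v → Dec (arcOf {P} p u v)
  arcOf? {P} (_ , _ , _ , inj₁ _) u v = consec? G (verts P) u v
  arcOf? {P} (_ , _ , _ , inj₂ _) u v = consec? G (verts P) v u

  arcOf-edge : (p : XY P) → arcOf {P} p u v → EdgeOf G P u v
  arcOf-edge (_ , _ , _ , inj₁ _) c = inj₁ c
  arcOf-edge (_ , _ , _ , inj₂ _) c = inj₂ c

  edge-arcOf : (p : XY P) → EdgeOf G P u v → arcOf {P} p u v ⊎ arcOf {P} p v u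
  edge-arcOf (_ , _ , _ , inj₁ _) e = e
  edge-arcOf (_ , _ , _ , inj₂ _) e = swap e

  edge-on : EdgeOf G P u v → OnPath G P u × OnPath G P v
  edge-on (inj₁ c) = consec-∈ˡ G c , consec-∈ G c
  edge-on (inj₂ c) = consec-∈ G c , consec-∈ˡ G c

  arcOf-functional : (p : XY P) → arcOf {P} p u v → arcOf {P} p u v′ → v ≡ v′
  arcOf-functional {P} (_ , _ , _ , inj₁ _) = consec-functional G (distinct P)
  arcOf-functional {P} (_ , _ , _ , inj₂ _) = consec-injective G (distinct P)

  arcOf-injective : (p : XY P) → arcOf {P} p u v → arcOf {P} p u′ v → u ≡ u′
  arcOf-injective {P} (_ , _ , _ , inj₁ _) = consec-injective G (distinct P)
  arcOf-injective {P} (_ , _ , _ , inj₂ _) = consec-functional G (distinct P)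

  arcOf-end : (p : XY P) → OnPath G P v → (∀ w → ¬ arcOf {P} p v w) → v ∈ₛ Y
  arcOf-end (a , b , (_ , last) , inj₁ (_ , b∈Y)) on none =
    subst (_∈ₛ Y) (sym (trans (no-next⇒lastV G {d = a} on none) last)) b∈Y
  arcOf-end (a , b , (first , _) , inj₂ (_ , a∈Y)) on none =
    subst (_∈ₛ Y) (sym (trans (no-previous⇒firstV G {d = a} on none) first)) a∈Y

  startOf : XY P → V
  startOf (a , _ , _ , inj₁ _) = a
  startOf (_ , b , _ , inj₂ _) = b

  startOf-on : (p : XY P) → OnPath G P (startOf {P} p)
  startOf-on {P} (a , _ , (first , _) , inj₁ _) =
    subst (_∈ verts P) first (firstV-∈ G {d = a} (nonempty P))
  startOf-on {P} (a , _ , (_ , last) , inj₂ _) =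
    subst (_∈ verts P) last (lastV-∈ G {d = a} (nonempty P))

  startOf-∈X : (p : XY P) → startOf {P} p ∈ₛ X
  startOf-∈X (_ , _ , _ , inj₁ (a∈X , _)) = a∈X
  startOf-∈X (_ , _ , _ , inj₂ (b∈X , _)) = b∈X

  startOf-first : (p : XY P) → ¬ arcOf {P} p u (startOf {P} p)
  startOf-first {P} {u} (a , _ , (first , _) , inj₁ _) c =
    firstV-no-previous G {d = a} (distinct P) (subst (Consec G (verts P) u) (sym first) c)
  startOf-first {P} {u} (a , _ , (_ , last) , inj₂ _) c =
    lastV-no-next G {d = a} (distinct P) (subst (λ w → Consec G (verts P) w u) (sym last) c)

  Arc : All XY 𝒫 → V → V → Set
  Arc [] u v = ⊥
  Arc (_∷_ {P} p ps) u v = arcOf {P} p u v ⊎ Arc ps u v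

  Arc? : (ps : All XY 𝒫) → ∀ u v → Dec (Arc ps u v)
  Arc? [] u v = no λ ()
  Arc? (_∷_ {P} p ps) u v = arcOf? {P} p u v ⊎-dec Arc? ps u v

  starts : All XY 𝒫 → List V
  starts [] = []
  starts (_∷_ {P} p ps) = startOf {P} p ∷ starts ps

  length-starts : (ps : All XY 𝒫) → length (starts ps) ≡ length 𝒫
  length-starts [] = refl
  length-starts (_ ∷ ps) = cong suc (length-starts ps)

  InV-there : InV G 𝒫 v → InV G (P ∷ 𝒫) v
  InV-there (Q , Q∈ , on) = Q , there Q∈ , on

  Arc-InE : (ps : All XY 𝒫) → Arc ps u v → InE G 𝒫 u v
  Arc-InE (_∷_ {P} p ps) (inj₁ a) = P , here refl , arcOf-edge {P} p a
  Arc-InE (p ∷ ps) (inj₂ a) = let (Q , Q∈ , e) = Arc-InE ps a in Q , there Q∈ , e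

  InE-Arc : (ps : All XY 𝒫) → InE G 𝒫 u v → Arc ps u v ⊎ Arc ps v u
  InE-Arc (_∷_ {P} p ps) (_ , here refl , e) = [ inj₁ ∘ inj₁ , inj₂ ∘ inj₁ ]′ (edge-arcOf {P} p e)
  InE-Arc (p ∷ ps) (Q , there Q∈ , e) = [ inj₁ ∘ inj₂ , inj₂ ∘ inj₂ ]′ (InE-Arc ps (Q , Q∈ , e))

  InE-InV : InE G 𝒫 u v → InV G 𝒫 u × InV G 𝒫 v
  InE-InV (P , P∈ , e) = let (on-u , on-v) = edge-on {P} e in (P , P∈ , on-u) , (P , P∈ , on-v)

  Arc-InV : (ps : All XY 𝒫) → Arc ps u v → InV G 𝒫 u × InV G 𝒫 v
  Arc-InV ps a = InE-InV (Arc-InE ps a)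

  arcOf-on : (p : XY P) → arcOf {P} p u v → OnPath G P u × OnPath G P v
  arcOf-on {P} p a = edge-on {P} (arcOf-edge {P} p a)

  head-disjoint : AllPairs (VertexDisjoint G) (P ∷ 𝒫) → OnPath G P v → ¬ InV G 𝒫 v
  head-disjoint (d ∷ _) on (Q , Q∈ , on′) = All.lookup d Q∈ _ on on′

  Arc-functional : (ps : All XY 𝒫) → AllPairs (VertexDisjoint G) 𝒫 →
    Arc ps u v → Arc ps u v′ → v ≡ v′
  Arc-functional (_∷_ {P} p ps) ds (inj₁ a) (inj₁ a′) = arcOf-functional {P} p a a′
  Arc-functional (_∷_ {P} p ps) ds (inj₁ a) (inj₂ a′) =
    contradiction (proj₁ (Arc-InV ps a′)) (head-disjoint ds (proj₁ (arcOf-on {P} p a)))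
  Arc-functional (_∷_ {P} p ps) ds (inj₂ a) (inj₁ a′) =
    contradiction (proj₁ (Arc-InV ps a)) (head-disjoint ds (proj₁ (arcOf-on {P} p a′)))
  Arc-functional (p ∷ ps) (_ ∷ ds) (inj₂ a) (inj₂ a′) = Arc-functional ps ds a a′

  Arc-injective : (ps : All XY 𝒫) → AllPairs (VertexDisjoint G) 𝒫 →
    Arc ps u v → Arc ps u′ v → u ≡ u′
  Arc-injective (_∷_ {P} p ps) ds (inj₁ a) (inj₁ a′) = arcOf-injective {P} p a a′
  Arc-injective (_∷_ {P} p ps) ds (inj₁ a) (inj₂ a′) =
    contradiction (proj₂ (Arc-InV ps a′)) (head-disjoint ds (proj₂ (arcOf-on {P} p a)))
  Arc-injective (_∷_ {P} p ps) ds (inj₂ a) (inj₁ a′) =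
    contradiction (proj₂ (Arc-InV ps a)) (head-disjoint ds (proj₂ (arcOf-on {P} p a′)))
  Arc-injective (p ∷ ps) (_ ∷ ds) (inj₂ a) (inj₂ a′) = Arc-injective ps ds a a′

  Arc-end : (ps : All XY 𝒫) → InV G 𝒫 v → (∀ w → ¬ Arc ps v w) → v ∈ₛ Y
  Arc-end (_∷_ {P} p ps) (_ , here refl , on) none = arcOf-end {P} p on (λ w → none w ∘ inj₁)
  Arc-end (p ∷ ps) (Q , there Q∈ , on) none = Arc-end ps (Q , Q∈ , on) (λ w → none w ∘ inj₂)

  starts-props : (ps : All XY 𝒫) → AllPairs (VertexDisjoint G) 𝒫 →
    All (λ s → InV G 𝒫 s × s ∈ₛ X × (∀ w → ¬ Arc ps w s)) (starts ps)
  starts-props [] _ = []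
  starts-props (_∷_ {P} p ps) ds@(_ ∷ ds′) =
    ((P , here refl , startOf-on {P} p) , startOf-∈X {P} p , first) ∷
    All.map later (starts-props ps ds′)
    where
    first : ∀ w → ¬ Arc (p ∷ ps) w (startOf {P} p)
    first w (inj₁ a) = startOf-first {P} p a
    first w (inj₂ a) = head-disjoint ds (startOf-on {P} p) (proj₂ (Arc-InV ps a))
    later : ∀ {s} → InV G _ s × s ∈ₛ X × (∀ w → ¬ Arc ps w s) →
      InV G (P ∷ _) s × s ∈ₛ X × (∀ w → ¬ Arc (p ∷ ps) w s)
    later (inV , x , none) = InV-there inV , x , λ
      { w (inj₁ a) → head-disjoint ds (proj₂ (arcOf-on {P} p a)) inV
      ; w (inj₂ a) → none w a }

  starts-unique : (ps : All XY 𝒫) → AllPairs (VertexDisjoint G) 𝒫 → Unique (starts ps)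
  starts-unique [] _ = []
  starts-unique (_∷_ {P} p ps) ds@(_ ∷ ds′) =
    All.map (λ { (inV , _) refl → head-disjoint ds (startOf-on {P} p) inV }) (starts-props ps ds′) ∷
    starts-unique ps ds′

-- The matching of extra edges and its four colours.

module ExtraEdges (G : Graph) (𝒫 : List (Path G))
  (disjoint : AllPairs (VertexDisjoint G) 𝒫) (sparse : AtMostOneExtraEdge G 𝒫) where

  private V = Fin (Graph.n G)

  Adj-sym : ∀ {u v} → Adj G u v → Adj G v u
  Adj-sym = trans (Graph.sym G _ _)

  InV? : ∀ v → Dec (InV G 𝒫 v)
  InV? v = map′ find (λ (P , P∈ , on) → lose P∈ on) (Any.any? (λ P → _∈?_ G v (verts P)) 𝒫)

  InE? : ∀ u v → Dec (InE G 𝒫 u v)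
  InE? u v = map′ find (λ (P , P∈ , e) → lose P∈ e)
    (Any.any? (λ P → consec? G (verts P) u v ⊎-dec consec? G (verts P) v u) 𝒫)

  InE-sym : ∀ {u v} → InE G 𝒫 u v → InE G 𝒫 v u
  InE-sym (P , P∈ , e) = P , P∈ , swap e

  -- Both ends are required to lie on the given paths: all trails stay on these vertices, and the
  -- relation becomes symmetric.
  Extra : V → V → Set
  Extra u v = InV G 𝒫 u × InV G 𝒫 v × Adj G u v × ¬ InE G 𝒫 u v

  Extra? : ∀ u v → Dec (Extra u v)
  Extra? u v = InV? u ×-dec InV? v ×-dec (Graph.adj G u v ≟ᵇ true) ×-dec ¬? (InE? u v)

  Extra-sym : ∀ {u v} → Extra u v → Extra v u
  Extra-sym (u∈ , v∈ , adj , ¬e) = v∈ , u∈ , Adj-sym adj , ¬e ∘ InE-sym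

  Extra-functional : ∀ {u v w} → Extra u v → Extra u w → v ≡ w
  Extra-functional (u∈ , _ , adj , ¬e) (_ , _ , adj′ , ¬e′) = sparse _ u∈ _ _ adj ¬e adj′ ¬e′

  -- mate v is v itself if no extra edge is incident to v.
  mate : V → V
  mate v with any? (Extra? v)
  ... | yes (u , _) = u
  ... | no _ = v

  Extra⇒mate : ∀ {u v} → Extra u v → mate u ≡ v
  Extra⇒mate {u} e with any? (Extra? u)
  ... | yes (_ , e′) = Extra-functional e′ e
  ... | no ¬e = contradiction (_ , e) ¬e

  mate⇒Extra : ∀ {v} → mate v ≢ v → Extra v (mate v)
  mate⇒Extra {v} mv≢v with any? (Extra? v)
  ... | yes (_ , e) = e
  ... | no _ = contradiction refl mv≢v

  mate-involutive : ∀ v → mate (mate v) ≡ v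
  mate-involutive v with mate v ≟ v
  ... | yes eq = trans (cong mate eq) eq
  ... | no mv≢v = Extra⇒mate (Extra-sym (mate⇒Extra mv≢v))

  Adj-mate : ∀ {v} → Adj G v (mate v) → mate v ≢ v
  Adj-mate {v} adj eq with trans (sym (subst (Adj G v) eq adj)) (Graph.irrefl G v)
  ... | ()

  -- With all paths in one list, a single greedy pass colours every extra edge. The new consecutive
  -- pairs where two paths meet only add constraints.
  vertexList : List V
  vertexList = concat (map verts 𝒫)

  vertexList-unique : Unique vertexList
  vertexList-unique = Unique.concat⁺ (All.map⁺ (All.tabulate λ {P} _ → distinct P))
    (AllPairs.map⁺ (AllPairs.map (λ d {v} (on , on′) → d v on on′) disjoint))

  InV⇒∈ : ∀ {v} → InV G 𝒫 v → v ∈ vertexList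
  InV⇒∈ (P , P∈ , on) = ∈-concat⁺′ on (∈-map⁺ verts P∈)

  consec-++ˡ : ∀ {l u v} l′ → Consec G l u v → Consec G (l ++ l′) u v
  consec-++ˡ l′ here = here
  consec-++ˡ l′ (there c) = there (consec-++ˡ l′ c)

  consec-++ʳ : ∀ {l u v} l′ → Consec G l u v → Consec G (l′ ++ l) u v
  consec-++ʳ [] c = c
  consec-++ʳ (_ ∷ l′) c = there (consec-++ʳ l′ c)

  consec-concat : ∀ {P : Path G} {𝒬 u v} → P ∈ 𝒬 → Consec G (verts P) u v →
    Consec G (concat (map verts 𝒬)) u v
  consec-concat (here refl) c = consec-++ˡ _ c
  consec-concat {𝒬 = Q ∷ _} (there P∈) c = consec-++ʳ (verts Q) (consec-concat P∈ c)

  open FourColouring G mate mate-involutive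

  colouring : Σ (V → Fin 4) λ col →
    (∀ {v} → mate v ≢ v → col (mate v) ≡ col v) ×
    (∀ {u v} → InE G 𝒫 u v → mate u ≢ u → mate v ≢ v → col u ≢ col v)
  colouring with four-colouring vertexList-unique
  ... | col , col-mate , col-consec = col , col-mate ∘ ready , col-edge
    where
    ready : ∀ {v} → mate v ≢ v → Ready vertexList v
    ready mv≢v = let (v∈ , mv∈ , _) = mate⇒Extra mv≢v in InV⇒∈ v∈ , InV⇒∈ mv∈ , mv≢v

    -- The last vertex of one path and the first of the next are consecutive in `vertexList` and may
    -- be mates, so `four-colouring` has to exempt mates. Along a path edge this exemption never
    -- applies, because an extra edge is not a path edge.
    not-mates : ∀ {u v} → InE G 𝒫 u v → mate u ≢ u → mate u ≢ v
    not-mates e mu≢u refl = proj₂ (proj₂ (proj₂ (mate⇒Extra mu≢u))) e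

    col-edge : ∀ {u v} → InE G 𝒫 u v → mate u ≢ u → mate v ≢ v → col u ≢ col v
    col-edge e@(P , P∈ , inj₁ c) mu≢u mv≢v =
      col-consec (consec-concat P∈ c) (ready mu≢u) (ready mv≢v) (not-mates e mu≢u)
    col-edge e@(P , P∈ , inj₂ c) mu≢u mv≢v =
      col-consec (consec-concat P∈ c) (ready mv≢v) (ready mu≢u) (not-mates (InE-sym e) mv≢v) ∘ sym

-- Assembling the four rounds.

consec-linked : ∀ (G : Graph) {l u v} → Linked (Adj G) l → Consec G l u v → Adj G u v
consec-linked G (a ∷ _) here = a
consec-linked G (_ ∷ as) (there c) = consec-linked G as c

theorem1p7 : (k : ℕ) → 1 ≤ k → (G : Graph) → (X Y : Subset (Graph.n G)) →
    (𝒫 : List (Path G)) → 16 * k ≤ length 𝒫 → All (IsXYPath G X Y) 𝒫 →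
    AllPairs (VertexDisjoint G) 𝒫 → AtMostOneExtraEdge G 𝒫 →
    Σ (List (Path G)) (λ 𝒬 → k ≤ length 𝒬 × All (IsXYPath G X Y) 𝒬
    × AllPairs (NonAdjacent G) 𝒬)
theorem1p7 k _ G X Y 𝒫 16k≤ xy disjoint sparse =
  -- One round for each of the four colours, each costing a factor of two, accounts for the constant
  -- 16.
  let (S₁ , h₁) = halve S₀ (2 * (2 * (2 * k))) (subst₂ _≤_ 16k≡ (sym (length-starts xy)) 16k≤)
      (S₂ , h₂) = halve S₁ (2 * (2 * k)) h₁
      (S₃ , h₃) = halve S₂ (2 * k) h₂
      (S₄ , h₄) = halve S₃ k h₃
      (𝒬 , len , xy′ , nonadjacent , _) = paths S₄
  in 𝒬 , subst (k ≤_) (sym len) h₄ , xy′ , nonadjacent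
  where
  open Orientation G X Y
  open ExtraEdges G 𝒫 disjoint sparse

  col : Fin (Graph.n G) → ℕ
  col v = toℕ (proj₁ colouring v)

  open Rounds (Adj G) (Arc xy) (_∈ₛ X) (_∈ₛ Y) mate col mate-involutive
    (λ mv≢v → proj₁ (proj₂ (proj₂ (mate⇒Extra mv≢v)))) Adj-mate
    (λ mv≢v → cong toℕ (proj₁ (proj₂ colouring) mv≢v))
    (λ a mu≢u mv≢v eq → proj₂ (proj₂ colouring) (Arc-InE xy a) mu≢u mv≢v (Fin.toℕ-injective eq))

  InE-adj : ∀ {u v} → InE G 𝒫 u v → Adj G u v
  InE-adj (P , _ , inj₁ c) = consec-linked G (linked P) c
  InE-adj (P , _ , inj₂ c) = Adj-sym (consec-linked G (linked P) c)

  edges₀ : ∀ {u v} → InV G 𝒫 u → InV G 𝒫 v → Adj G u v →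
    Arc xy u v ⊎ Arc xy v u ⊎ (mate u ≡ v × 0 ≤ col u)
  edges₀ {u} {v} u∈ v∈ adj with InE? u v
  ... | yes e = [ inj₁ , inj₂ ∘ inj₁ ]′ (InE-Arc xy e)
  ... | no ¬e = inj₂ (inj₂ (Extra⇒mate (u∈ , v∈ , adj , ¬e) , z≤n))

  S₀ : System 0
  S₀ = record
    { W = InV G 𝒫 ; W? = InV? ; arc = Arc xy ; arc? = Arc? xy
    ; arc-W = Arc-InV xy ; arc-adj = InE-adj ∘ Arc-InE xy
    ; functional = Arc-functional xy disjoint ; injective = Arc-injective xy disjoint
    ; arc-origin = inj₁ ; edges = edges₀ ; end∈Y = Arc-end xy
    ; starts = starts xy ; unique = starts-unique xy disjoint
    ; start-props = starts-props xy disjoint }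

  16k≡ : 16 * k ≡ 2 * (2 * (2 * (2 * k)))
  16k≡ = trans (ℕ.*-assoc 8 2 k) (trans (ℕ.*-assoc 4 2 (2 * k)) (ℕ.*-assoc 2 2 (2 * (2 * k))))

  paths : (S : System 4) → Σ (List (Path G)) λ 𝒬 → length 𝒬 ≡ length (System.starts S) ×
    All (IsXYPath G X Y) 𝒬 × AllPairs (NonAdjacent G) 𝒬 × _
  paths S = nonadjacent-paths unique start-props
    where
    open System S
    edges′ : ∀ {u v} → W u → W v → Adj G u v → arc u v ⊎ arc v u
    edges′ {u} w-u w-v adj with edges w-u w-v adj
    ... | inj₁ a = inj₁ a
    ... | inj₂ (inj₁ a) = inj₂ a
    -- An extra edge surviving all rounds would need a colour of at least 4, but colours come from
    -- `Fin 4`.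
    ... | inj₂ (inj₂ (_ , 4≤col)) = contradiction 4≤col (ℕ.<⇒≱ (Fin.toℕ<n (proj₁ colouring u)))
    open Trails G X Y W arc arc? (proj₂ ∘ arc-W) arc-adj injective edges′ end∈Y
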